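{- Let $G$ and $H$ be graphs with no isolated vertices. Then $$\gamma_{oir2}(G\times H)\leq \min\{\gamma_{oir2}(H)\,|V(G)|,\ \gamma_{oir2}(G)\,|V(H)|\}.$$
   Context: All graphs are finite and simple. For a graph $G$, a function $f:V(G)\to\mathcal{P}(\{1,2\})$ is an outer-independent 2-rainbow dominating function (OI2RD function) if every vertex $v$ with $f(v)=\emptyset$ satisfies $\bigcup_{u\in N(v)}f(u)=\{1,2\}$ and the set $\{v: f(v)=\emptyset\}$ is independent. The weight of $f$ is $\sum_{v}|f(v)|$ and $\gamma_{oir2}(G)$ is the minimum weight of an OI2RD function of $G$. The direct product $G\times H$ has vertex set $V(G)\times V(H)$, with $(x,y)(x',y')$ an edge iff $xx'\in E(G)$ and $yy'\in E(H)$. -}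

module Defs where

import Algebra.Properties.CommutativeMonoid.Sum
open import Data.Bool.Properties using () renaming (_≟_ to _≟ᵇ_)
open import Data.Fin.Base using (Fin)
open import Data.Fin.Properties using (all?; *↔×)
open import Data.Fin.Subset using (Subset; ⊥; ⊤; ⋃; ∣_∣)
open import Data.Fin.Subset.Properties using (anySubset?)
open import Data.List.Base using (List; map; filter; allFin)
open import Data.List.Properties using (map-cong)
open import Data.Nat.Base using (ℕ; zero; suc; _*_; _≤_; _<_)
open import Data.Nat.Induction using (<-rec)
open import Data.Nat.Properties using (+-0-commutativeMonoid; _≟_; ≮⇒≥; anyUpTo?)
open import Data.Product.Base using (_×_; _,_; proj₁; ∃; ∃-syntax)
open import Data.Product.Function.NonDependent.Propositional using (_×-↔_)
open import Data.Vec.Base using (Vec; []; _∷_; lookup; tabulate)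
open import Data.Vec.Properties using (≡-dec; lookup∘tabulate)
open import Function.Base using (_∘_)
open import Function.Bundles using (_↔_; Inverse)
open import Function.Construct.Composition using (_↔-∘_)
open import Function.Construct.Symmetry using (↔-sym)
open import Relation.Binary.Core using (Rel)
import Relation.Binary.Definitions as B
open import Relation.Binary.PropositionalEquality
  using (_≡_; _≗_; refl; sym; trans; cong; subst)
open import Relation.Nullary.Decidable using (Dec; yes; no; map′; ¬?; _×-dec_; _→-dec_)
open import Relation.Nullary.Negation using (¬_; contradiction)
open import Relation.Unary using (Pred; Decidable)
open import Level using (0ℓ)

open Algebra.Properties.CommutativeMonoid.Sum +-0-commutativeMonoid public
  using (sum)
open Algebra.Properties.CommutativeMonoid.Sum +-0-commutativeMonoid
  using (sum-cong-≗)

-- Adjacency is required to be decidable, so that the minimum defining γoir2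
-- exists constructively.  The null graph is allowed.
record Graph : Set₁ where
  infix 4 _~_ _~?_
  field
    V      : Set
    order  : ℕ
    enum   : V ↔ Fin order
    _~_    : Rel V 0ℓ
    _~?_   : B.Decidable _~_
    ~-sym    : B.Symmetric _~_
    ~-irrefl : B.Irreflexive _≡_ _~_

  open Inverse enum public
    using ()
    renaming (to to index; from to vertex; strictlyInverseʳ to vertex∘index)

  vertices : List V
  vertices = map vertex (allFin order)

  N : V → List V
  N v = filter (v ~?_) vertices

  Independent : Pred V 0ℓ → Set
  Independent S = ∀ {u v} → S u → S v → ¬ (u ~ v)

NoIsolatedVertices : Graph → Set
NoIsolatedVertices G = ∀ v → ∃[ u ] v ~ u
  where open Graph G

infixr 7 _×ᴳ_

_×ᴳ_ : Graph → Graph → Graph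
G ×ᴳ H = record
  { V        = G.V × H.V
  ; order    = G.order * H.order
  ; enum     = ↔-sym *↔× ↔-∘ (G.enum ×-↔ H.enum)
  ; _~_      = λ (x , y) (x′ , y′) → (x G.~ x′) × (y H.~ y′)
  ; _~?_     = λ (x , y) (x′ , y′) → (x G.~? x′) ×-dec (y H.~? y′)
  ; ~-sym    = λ (p , q) → G.~-sym p , H.~-sym q
  ; ~-irrefl = λ eq (p , _) → G.~-irrefl (cong proj₁ eq) p
  }
  where
  module G = Graph G
  module H = Graph H

module _ (G : Graph) where
  open Graph G

  -- The colours 1 and 2 are the two elements of Fin 2, so that ⊥ is ∅ and
  -- ⊤ is {1,2}.
  Labelling : Set
  Labelling = V → Subset 2

  record IsOI2RD (f : Labelling) : Set where
    field
      dominating       : ∀ v → f v ≡ ⊥ → ⋃ (map f (N v)) ≡ ⊤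
      outerIndependent : Independent (λ v → f v ≡ ⊥)

  weight : Labelling → ℕ
  weight f = sum (λ i → ∣ f (vertex i) ∣)

  record IsMinimumWeight (k : ℕ) : Set where
    field
      attained   : ∃[ f ] IsOI2RD f × weight f ≡ k
      lowerBound : ∀ f → IsOI2RD f → k ≤ weight f

private
  _≟ˢ_ : ∀ {n} → B.DecidableEquality (Subset n)
  _≟ˢ_ = ≡-dec _≟ᵇ_

  anyVec? : ∀ {m} n {P : Pred (Vec (Subset m) n) 0ℓ} → Decidable P → Dec (∃ P)
  anyVec? zero    P? = map′ ([] ,_) (λ { ([] , p) → p }) (P? [])
  anyVec? (suc n) P? =
    map′ (λ (s , ss , p) → s ∷ ss , p) (λ { (s ∷ ss , p) → s , ss , p })
         (anySubset? λ s → anyVec? n λ ss → P? (s ∷ ss))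

  least : {P : Pred ℕ 0ℓ} → Decidable P → ∀ n → P n →
          ∃[ k ] P k × (∀ j → P j → k ≤ j)
  least {P} P? = <-rec (λ n → P n → ∃[ k ] P k × (∀ j → P j → k ≤ j)) step
    where
    step : ∀ n → (∀ {m} → m < n → P m → ∃[ k ] P k × (∀ j → P j → k ≤ j)) →
           P n → ∃[ k ] P k × (∀ j → P j → k ≤ j)
    step n rec pn with anyUpTo? P? n
    ... | yes (m , m<n , pm) = rec m<n pm
    ... | no  none           =
      n , pn , λ j pj → ≮⇒≥ λ j<n → none (j , j<n , pj)

  module _ (G : Graph) where
    open Graph G

    allV? : {P : Pred V 0ℓ} → Decidable P → Dec (∀ v → P v)
    allV? {P} P? =
      map′ (λ h v → subst P (vertex∘index v) (h (index v))) (λ h → h ∘ vertex)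
           (all? (P? ∘ vertex))

    isOI2RD? : Decidable (IsOI2RD G)
    isOI2RD? f =
      map′ (λ (d , i) → record
             { dominating = d ; outerIndependent = λ {u} {v} → i u v })
           (λ o → IsOI2RD.dominating o , λ u v → IsOI2RD.outerIndependent o {u} {v})
           (allV? (λ v → (f v ≟ˢ ⊥) →-dec (⋃ (map f (N v)) ≟ˢ ⊤))
            ×-dec
            allV? (λ u → allV? λ v →
              (f u ≟ˢ ⊥) →-dec ((f v ≟ˢ ⊥) →-dec ¬? (u ~? v))))

    isOI2RD-resp : ∀ {f g} → f ≗ g → IsOI2RD G f → IsOI2RD G g
    isOI2RD-resp f≗g o = record
      { dominating = λ v gv≡⊥ →
          trans (cong ⋃ (sym (map-cong f≗g (N v))))
                (IsOI2RD.dominating o v (trans (f≗g v) gv≡⊥))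
      ; outerIndependent = λ {u} {v} gu≡⊥ gv≡⊥ →
          IsOI2RD.outerIndependent o (trans (f≗g u) gu≡⊥) (trans (f≗g v) gv≡⊥)
      }

    weight-cong : ∀ {f g} → f ≗ g → weight G f ≡ weight G g
    weight-cong f≗g = sum-cong-≗ (λ i → cong ∣_∣ (f≗g (vertex i)))

    decode : Vec (Subset 2) order → Labelling G
    decode xs v = lookup xs (index v)

    encode : Labelling G → Vec (Subset 2) order
    encode f = tabulate (f ∘ vertex)

    decode∘encode : ∀ f → f ≗ decode (encode f)
    decode∘encode f v =
      sym (trans (lookup∘tabulate (f ∘ vertex) (index v)) (cong f (vertex∘index v)))

    Attained : Pred ℕ 0ℓ
    Attained k = ∃[ f ] IsOI2RD G f × weight G f ≡ k

    attained? : Decidable Attained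
    attained? k =
      map′ (λ (xs , p) → decode xs , p)
           (λ (f , o , eq) → encode f
                           , isOI2RD-resp (decode∘encode f) o
                           , trans (sym (weight-cong (decode∘encode f))) eq)
           (anyVec? order λ xs →
             isOI2RD? (decode xs) ×-dec (weight G (decode xs) ≟ k))

    full : IsOI2RD G (λ _ → ⊤)
    full = record { dominating = λ _ () ; outerIndependent = λ () }

minimumWeight : ∀ G → ∃[ k ] IsMinimumWeight G k
minimumWeight G with least (attained? G) _ (_ , full G , refl)
... | k , att , low = k , record
  { attained   = att
  ; lowerBound = λ f o → low (weight G f) (f , o , refl)
  }

γoir2 : Graph → ℕ
γoir2 G = proj₁ (minimumWeight G)

{-# OPTIONS --safe #-}

-- If π : K → G is a graph homomorphism mapping each neighbourhood onto a
-- neighbourhood, then f ∘ π is an OI2RD function of K whenever f is one of G: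
-- every u ∼ π v has a preimage adjacent to v, so v sees at least the labels
-- that π v sees.  When G and H have no isolated vertices, both projections of
-- G × H have this property, and their fibres have |V(H)| and |V(G)| elements.
module Submission where

open import Defs
import Algebra.Properties.CommutativeMonoid.Sum
open import Data.Fin.Base using (Fin; zero; suc; _↑ˡ_; _↑ʳ_; combine; remQuot)
open import Data.Fin.Properties using (remQuot-combine)
open import Data.Fin.Subset using (Subset; ⋃; ∣_∣; _⊆_)
open import Data.Fin.Subset.Properties
  using (⊆-antisym; ⊆⊤; ⊥⊆; ⊆-trans; p⊆p∪q; q⊆p∪q; x∈p∪q⁻)
open import Data.List.Base using ([]; _∷_; map)
open import Data.List.Membership.Propositional using (_∈_)
open import Data.List.Membership.Propositional.Properties
  using (∈-allFin; ∈-map⁺; ∈-map⁻; ∈-filter⁺; ∈-filter⁻)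
open import Data.List.Relation.Unary.Any using (here; there)
open import Data.Nat.Base using (ℕ; zero; suc; _+_; _≤_; _*_; _⊓_)
open import Data.Nat.Properties
  using (+-0-commutativeMonoid; +-assoc; *-comm; ⊓-glb; module ≤-Reasoning)
open import Data.Product.Base using (_×_; _,_; proj₁; proj₂; ∃-syntax)
open import Data.Sum.Base using ([_,_]′)
open import Function.Base using (_∘_)
open import Relation.Binary.PropositionalEquality
  using (_≡_; refl; sym; trans; cong; subst; module ≡-Reasoning)

open Algebra.Properties.CommutativeMonoid.Sum +-0-commutativeMonoid
  using (sum-cong-≗; ∑-comm)

sum-const : ∀ n c → sum {n} (λ _ → c) ≡ n * c
sum-const zero    c = refl
sum-const (suc n) c = cong (c +_) (sum-const n c)

sum-++ : ∀ m {n} (t : Fin (m + n) → ℕ) →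
         sum t ≡ sum (λ i → t (i ↑ˡ n)) + sum (λ j → t (m ↑ʳ j))
sum-++ zero    t = refl
sum-++ (suc m) t = trans (cong (t zero +_) (sum-++ m (t ∘ suc)))
                         (sym (+-assoc (t zero) _ _))

-- Induction on `m`: `combine zero j` unfolds to `j ↑ˡ (m * n)` and `combine (suc i) j` to
-- `n ↑ʳ combine i j`, so `sum-++` splits off the first row of `n` terms.
sum-combine : ∀ m n (t : Fin (m * n) → ℕ) →
              sum t ≡ sum {m} (λ i → sum {n} (λ j → t (combine i j)))
sum-combine zero    n t = refl
sum-combine (suc m) n t = trans (sum-++ n t)
  (cong (sum {n} (λ j → t (j ↑ˡ (m * n))) +_) (sum-combine m n (t ∘ (n ↑ʳ_))))

sum-remQuot : ∀ m n (t : Fin m × Fin n → ℕ) →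
              sum {m * n} (t ∘ remQuot n) ≡ sum {m} (λ i → sum {n} (λ j → t (i , j)))
sum-remQuot m n t = trans (sum-combine m n (t ∘ remQuot n))
  (sum-cong-≗ λ i → sum-cong-≗ λ j → cong t (remQuot-combine i j))

⊆⋃ : ∀ {n} {p : Subset n} {ps} → p ∈ ps → p ⊆ ⋃ ps
⊆⋃ {ps = p ∷ ps} (here refl)  = p⊆p∪q (⋃ ps)
⊆⋃ {ps = q ∷ ps} (there p∈ps) = ⊆-trans (⊆⋃ p∈ps) (q⊆p∪q q (⋃ ps))

⋃⊆ : ∀ {n} {q : Subset n} ps → (∀ {p} → p ∈ ps → p ⊆ q) → ⋃ ps ⊆ q
⋃⊆ []       ps⊆q = ⊥⊆
⋃⊆ (p ∷ ps) ps⊆q x∈∪ =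
  [ ps⊆q (here refl) , ⋃⊆ ps (ps⊆q ∘ there) ]′ (x∈p∪q⁻ p (⋃ ps) x∈∪)

module _ (G : Graph) where
  open Graph G

  ∈-vertices : ∀ v → v ∈ vertices
  ∈-vertices v =
    subst (_∈ vertices) (vertex∘index v) (∈-map⁺ vertex (∈-allFin (index v)))

  ∈-N⁺ : ∀ {u v} → v ~ u → u ∈ N v
  ∈-N⁺ {u} {v} = ∈-filter⁺ (v ~?_) (∈-vertices u)

  ∈-N⁻ : ∀ {u v} → u ∈ N v → v ~ u
  ∈-N⁻ {u} {v} = proj₂ ∘ ∈-filter⁻ (v ~?_) {xs = vertices}

  -- This and `γoir2-attained` read off the certificate paired with the minimum, so the search
  -- computing it need not be unfolded.
  γoir2≤weight : ∀ {f} → IsOI2RD G f → γoir2 G ≤ weight G f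
  γoir2≤weight = IsMinimumWeight.lowerBound (proj₂ (minimumWeight G)) _

  γoir2-attained : ∃[ f ] IsOI2RD G f × weight G f ≡ γoir2 G
  γoir2-attained = IsMinimumWeight.attained (proj₂ (minimumWeight G))

-- In a pullback, `hom` carries outer independence and `lift` carries domination.
record IsLocallySurjectiveHom (K G : Graph) (π : Graph.V K → Graph.V G) : Set where
  private
    module K = Graph K
    module G = Graph G
  field
    hom  : ∀ {v w} → v K.~ w → π v G.~ π w
    lift : ∀ v {u} → π v G.~ u → ∃[ w ] v K.~ w × π w ≡ u

module _ {K G : Graph} {π : Graph.V K → Graph.V G}
         (π-lsh : IsLocallySurjectiveHom K G π) where
  private
    module K = Graph K
    module G = Graph G
  open IsLocallySurjectiveHom π-lsh

  ⋃-N-pullback : ∀ (f : Labelling G) v →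
                 ⋃ (map f (G.N (π v))) ⊆ ⋃ (map (f ∘ π) (K.N v))
  ⋃-N-pullback f v = ⋃⊆ _ λ p∈ → label⊆ (∈-map⁻ f p∈)
    where
    label⊆ : ∀ {p} → ∃[ u ] u ∈ G.N (π v) × p ≡ f u → p ⊆ ⋃ (map (f ∘ π) (K.N v))
    label⊆ (u , u∈N , refl) with lift v (∈-N⁻ G u∈N)
    ... | w , v~w , refl = ⊆⋃ (∈-map⁺ (f ∘ π) (∈-N⁺ K v~w))

  isOI2RD-pullback : ∀ {f} → IsOI2RD G f → IsOI2RD K (f ∘ π)
  isOI2RD-pullback {f} o = record
    -- `fv≡⊥` is literally the statement that `f` is empty at `π v`, so domination in `G` turns the
    -- left side of `⋃-N-pullback` into `⊤`.
    { dominating       = λ v fv≡⊥ → ⊆-antisym ⊆⊤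
        (subst (_⊆ ⋃ (map (f ∘ π) (K.N v))) (dominating (π v) fv≡⊥) (⋃-N-pullback f v))
    ; outerIndependent = λ fu≡⊥ fv≡⊥ u~v → outerIndependent fu≡⊥ fv≡⊥ (hom u~v)
    }
    where open IsOI2RD o

module _ (G H : Graph) where
  private
    module G = Graph G
    module H = Graph H

  proj₁-locallySurjective : NoIsolatedVertices H →
                            IsLocallySurjectiveHom (G ×ᴳ H) G proj₁
  proj₁-locallySurjective nonIsolated = record
    { hom  = proj₁
    -- The first coordinate is forced to be `u`; any neighbour of `y` serves as the second.
    ; lift = λ (_ , y) {u} x~u → let y′ , y~y′ = nonIsolated y in
                                 (u , y′) , (x~u , y~y′) , refl
    }

  proj₂-locallySurjective : NoIsolatedVertices G →
                            IsLocallySurjectiveHom (G ×ᴳ H) H proj₂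
  proj₂-locallySurjective nonIsolated = record
    { hom  = proj₂
    ; lift = λ (x , _) {u} y~u → let x′ , x~x′ = nonIsolated x in
                                 (x′ , u) , (x~x′ , y~u) , refl
    }

  weight-× : ∀ f → weight (G ×ᴳ H) f ≡
             sum (λ i → sum (λ j → ∣ f (G.vertex i , H.vertex j) ∣))
  -- The enumeration of `G ×ᴳ H` decodes an index by `remQuot` and then applies `vertex` in each
  -- factor, so the weight already has the form required.
  weight-× f = sum-remQuot G.order H.order
    λ (i , j) → ∣ f (G.vertex i , H.vertex j) ∣

  weight-proj₂ : ∀ f → weight (G ×ᴳ H) (f ∘ proj₂) ≡ weight H f * G.order
  weight-proj₂ f = begin
    weight (G ×ᴳ H) (f ∘ proj₂)         ≡⟨ weight-× (f ∘ proj₂) ⟩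
    sum {G.order} (λ _ → weight H f)    ≡⟨ sum-const G.order (weight H f) ⟩
    G.order * weight H f                ≡⟨ *-comm G.order (weight H f) ⟩
    weight H f * G.order                ∎
    where open ≡-Reasoning

  weight-proj₁ : ∀ f → weight (G ×ᴳ H) (f ∘ proj₁) ≡ weight G f * H.order
  weight-proj₁ f = begin
    weight (G ×ᴳ H) (f ∘ proj₁)
      ≡⟨ weight-× (f ∘ proj₁) ⟩
    sum {G.order} (λ i → sum {H.order} (λ _ → ∣ f (G.vertex i) ∣))
      -- Here the label depends on the outer index; exchanging the sums makes each inner sum
      -- `weight G f`, as it is from the start for `proj₂`.
      ≡⟨ ∑-comm {G.order} {H.order} (λ i _ → ∣ f (G.vertex i) ∣) ⟩
    sum {H.order} (λ _ → weight G f)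
      ≡⟨ sum-const H.order (weight G f) ⟩
    H.order * weight G f
      ≡⟨ *-comm H.order (weight G f) ⟩
    weight G f * H.order
      ∎
    where open ≡-Reasoning

  γoir2-×≤ʳ : NoIsolatedVertices G → γoir2 (G ×ᴳ H) ≤ γoir2 H * G.order
  -- The competitor repeats an optimal labelling of `H` on the copy of `V(H)` over each vertex of
  -- `G`.
  γoir2-×≤ʳ nonIsolated = let f , o , f≡γ = γoir2-attained H in begin
    γoir2 (G ×ᴳ H)
      ≤⟨ γoir2≤weight (G ×ᴳ H)
           (isOI2RD-pullback (proj₂-locallySurjective nonIsolated) o) ⟩
    weight (G ×ᴳ H) (f ∘ proj₂)  ≡⟨ weight-proj₂ f ⟩
    weight H f * G.order         ≡⟨ cong (_* G.order) f≡γ ⟩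
    γoir2 H * G.order            ∎
    where open ≤-Reasoning

  γoir2-×≤ˡ : NoIsolatedVertices H → γoir2 (G ×ᴳ H) ≤ γoir2 G * H.order
  γoir2-×≤ˡ nonIsolated = let f , o , f≡γ = γoir2-attained G in begin
    γoir2 (G ×ᴳ H)
      ≤⟨ γoir2≤weight (G ×ᴳ H)
           (isOI2RD-pullback (proj₁-locallySurjective nonIsolated) o) ⟩
    weight (G ×ᴳ H) (f ∘ proj₁)  ≡⟨ weight-proj₁ f ⟩
    weight G f * H.order         ≡⟨ cong (_* H.order) f≡γ ⟩
    γoir2 G * H.order            ∎
    where open ≤-Reasoning

theorem2 : (G H : Graph) → NoIsolatedVertices G → NoIsolatedVertices H →
    γoir2 (G ×ᴳ H) ≤ (γoir2 H * Graph.order G) ⊓ (γoir2 G * Graph.order H)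
theorem2 G H G-nonIsolated H-nonIsolated =
  ⊓-glb (γoir2-×≤ʳ G H G-nonIsolated) (γoir2-×≤ˡ G H H-nonIsolated)
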